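{- Let $k,d,m$ be positive integers with $k\ge d$. Let $\mathcal{F}$ be a family of sets of size at most $k$ over a finite ground set $X$ such that the size of each element of $\mathcal{F}$ is a multiple of $d$, and $\mathcal{F}$ does not contain $m$ members whose pairwise intersection sizes are all non-zero modulo $d$. Let $w$ be a non-negative weighting on $\mathcal{F}$ and define $w'(F)=\left(\frac{1}{d\binom{k}{d-1}m}\right)^{|F|/d}w(F)$ for $F\in\mathcal{F}$. Then, for some non-negative integer $n$, there are pairwise disjoint subsets $X_1,\dots,X_n\subseteq X$ of size $d$ each such that, setting $\mathcal{F}'=\{F\in\mathcal{F}: F \text{ is a union of some of the sets } X_i\}$, we have $\sum_{F\in\mathcal{F}'}w(F)\ge\sum_{F\in\mathcal{F}}w'(F)$.
   Formalization: The non-negative weighting w on the family is taken to be rational-valued instead of real-valued. -}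

module Defs where

open import Data.Nat as ℕ using (ℕ; zero; suc)
open import Data.Nat.Combinatorics using (_C_)
open import Data.Integer using (+_)
open import Data.Rational as ℚ using (ℚ; 0ℚ; 1ℚ; _/_)
open import Data.Bool using (Bool; true; false; if_then_else_)
open import Data.Bool.Properties using () renaming (_≟_ to _≟ᵇ_)
open import Data.Fin using (Fin)
import Data.Fin as Fin
open import Data.Fin.Subset using (Subset; ⊥; _∪_; _∩_; ∣_∣)
open import Data.Fin.Subset.Properties using (anySubset?)
open import Data.Vec using (Vec; []; _∷_)
open import Data.Vec.Properties using (≡-dec)
open import Data.List using (List; []; _∷_)
open import Data.Product using (∃)
open import Relation.Binary.PropositionalEquality using (_≡_)
open import Relation.Nullary using (Dec; does)

_^ℚ_ : ℚ → ℕ → ℚ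
q ^ℚ zero  = 1ℚ
q ^ℚ suc e = q ℚ.* (q ^ℚ e)

-- 1/n as a rational (convention 1/0 := 0; only used with n > 0).
inv : ℕ → ℚ
inv zero    = 0ℚ
inv (suc n) = + 1 / suc n

sumℚ : List ℚ → ℚ
sumℚ []       = 0ℚ
sumℚ (q ∷ qs) = q ℚ.+ sumℚ qs

unionSel : {N n : ℕ} → (Fin n → Subset N) → Subset n → Subset N
unionSel {n = zero}  Xs []      = ⊥
unionSel {n = suc n} Xs (b ∷ s) =
  (if b then Xs Fin.zero else ⊥) ∪ unionSel (λ i → Xs (Fin.suc i)) s

IsUnionOf : {N n : ℕ} → (Fin n → Subset N) → Subset N → Set
IsUnionOf Xs F = ∃ λ s → F ≡ unionSel Xs s

isUnionOf? : {N n : ℕ} → (Xs : Fin n → Subset N) → (F : Subset N) → Dec (IsUnionOf Xs F)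
isUnionOf? Xs F = anySubset? (λ s → ≡-dec _≟ᵇ_ F (unionSel Xs s))

sumOverUnions : {N n : ℕ} → (Fin n → Subset N) → List (Subset N) → (Subset N → ℚ) → ℚ
sumOverUnions Xs []         w = 0ℚ
sumOverUnions Xs (F ∷ fam) w =
  (if does (isUnionOf? Xs F) then w F else 0ℚ) ℚ.+ sumOverUnions Xs fam w

w′ : (k d m : ℕ) .{{_ : ℕ.NonZero d}} → {N : ℕ} → (Subset N → ℚ) → Subset N → ℚ
w′ k d m w F = (inv (d ℕ.* (k C (d ℕ.∸ 1)) ℕ.* m) ^ℚ (∣ F ∣ ℕ./ d)) ℚ.* w F

{-# OPTIONS --safe #-}
module Submission where

-- Write w′ with M = d · C(k, d-1) · m, and call members F, G orthogonal if d divides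
-- |F ∩ G|. Among the d-sets contained in members choose D maximising the w′-weight f of
-- the members containing D. Fix x ∈ D and a maximal family of pairwise non-orthogonal
-- members through x, which has fewer than m elements G. Every member F through x is
-- orthogonal to one of these G, so |F ∩ G| ≥ d and F contains one of the at most
-- m · C(k, d-1) d-sets D′ with x ∈ D′ ⊆ G; hence the members through x weigh at most
-- m · C(k, d-1) · f, and those meeting D at most M · f. Discard the members meeting D
-- without containing it and remove D from the others: this gains a factor M on those
-- containing D, so the total w′-weight does not decrease, and orthogonality modulo d is
-- not affected. Iterating, the chosen sets D are the required blocks.

open import Defs
open import Data.Nat as ℕ using (ℕ; zero; suc; _≤_; _%_; NonZero; s≤s; z≤n)
import Data.Nat.Properties as ℕ
open import Data.Nat.Combinatorics using (_C_; nCn≡1; nCk≡nC[n∸k]; nCk+nC[k+1]≡[n+1]C[k+1]; k>n⇒nCk≡0)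
open import Data.Nat.Divisibility using (_∣_; _∣?_; _∣0; ∣-reflexive; ∣⇒≤; ∣m+n∣m⇒∣n; m%n≡0⇒n∣m)
open import Data.Nat.DivMod using (m/n≡1+[m∸n]/n)
open import Data.Nat.Induction using (Acc; acc; <-wellFounded)
open import Data.Rational as ℚ using (ℚ; 0ℚ; 1ℚ) renaming (_≤_ to _≤ℚ_)
import Data.Rational.Properties as ℚ
open import Data.Rational.Unnormalised as ℚᵘ using (mkℚᵘ; *≡*)
import Data.Rational.Unnormalised.Properties as ℚᵘ
open import Data.Integer as ℤ using (+_)
import Data.Integer.Properties as ℤ
open import Data.Bool using (true; false; if_then_else_)
open import Data.Fin using (Fin; zero; suc; inject≤; _≟_)
open import Data.Fin.Properties using (inject≤-injective)
open import Data.Fin.Subset using (Subset; ⊥; ⊤; _∪_; _∩_; _─_; _-_; ∣_∣; ⁅_⁆; _⊆_; Empty; Nonempty)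
  renaming (_∈_ to _∈ˢ_; _∉_ to _∉ˢ_)
open import Data.Fin.Subset.Properties
open import Data.List using (List; []; _∷_; map; length; filter; concatMap; _++_; lookup)
open import Data.List.Properties using (length-map; length-++)
open import Relation.Binary.Bundles using (DecTotalOrder)
open import Data.List.Extrema (DecTotalOrder.totalOrder ℚ.≤-decTotalOrder)
  using (argmax; argmax-sel; f[⊥]≤f[argmax]; f[xs]≤f[argmax])
open import Data.List.Membership.Propositional using (_∈_; lose; find)
open import Data.List.Membership.Propositional.Properties
open import Data.List.Relation.Unary.Any as Any using (Any; here; there)
open import Data.List.Relation.Unary.Any.Properties using (¬Any[])
open import Data.List.Relation.Unary.All as All using (All; []; _∷_)
open import Data.List.Relation.Unary.All.Properties using (¬All⇒Any¬)
open import Data.List.Relation.Unary.AllPairs using (AllPairs; []; _∷_)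
open import Data.List.Relation.Unary.Unique.Propositional using (Unique)
open import Data.Product using (Σ; ∃; _×_; _,_; proj₁; proj₂)
open import Data.Sum using (_⊎_; inj₁; inj₂; [_,_]′)
open import Data.Vec using ([]; _∷_; here; there)
import Data.Vec.Functional as Vector
open import Function using (_∘_; id)
open import Function.Definitions using (Injective)
open import Relation.Binary.Core using (Rel)
open import Relation.Binary.Definitions using (Symmetric) renaming (Decidable to Decidable₂)
open import Relation.Unary using (Pred; Decidable)
open import Relation.Binary.PropositionalEquality
open import Relation.Nullary using (¬_; Dec; yes; no; does; contradiction; ¬?)
open import Relation.Nullary.Decidable using (_×-dec_; _⊎-dec_; decidable-stable)
open import Level using (0ℓ)
open import Algebra.Bundles using (CommutativeRing; CommutativeMonoid)
open import Algebra.Properties.CommutativeSemigroup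
  (CommutativeMonoid.commutativeSemigroup ℚ.+-0-commutativeMonoid)
  using () renaming (interchange to +-interchange)
open import Algebra.Properties.Semiring.Mult (CommutativeRing.semiring ℚ.+-*-commutativeRing)
  using () renaming (_×_ to _·_; ×-assoc-* to ·-assoc-*)

-- Sums over lists and their restriction to a predicate.

module _ {A : Set} where

  sumOver : (A → ℚ) → List A → ℚ
  sumOver f = sumℚ ∘ map f

  -- Giving excluded elements the value zero keeps all sums over one list, so that different
  -- conditions compare term by term; the `if` has the form used in `sumOverUnions`.
  restrict : {P : Pred A 0ℓ} → Decidable P → (A → ℚ) → A → ℚ
  restrict P? f x = if does (P? x) then f x else 0ℚ

  sumOver-mono : ∀ {f g} xs → (∀ {x} → x ∈ xs → f x ≤ℚ g x) → sumOver f xs ≤ℚ sumOver g xs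
  sumOver-mono []       f≤g = ℚ.≤-refl
  sumOver-mono (x ∷ xs) f≤g = ℚ.+-mono-≤ (f≤g (here refl)) (sumOver-mono xs (f≤g ∘ there))

  sumOver-0 : ∀ xs → sumOver (λ _ → 0ℚ) xs ≡ 0ℚ
  sumOver-0 []       = refl
  sumOver-0 (x ∷ xs) = trans (ℚ.+-identityˡ _) (sumOver-0 xs)

  sumOver-+ : ∀ f g xs → sumOver (λ x → f x ℚ.+ g x) xs ≡ sumOver f xs ℚ.+ sumOver g xs
  sumOver-+ f g []       = refl
  sumOver-+ f g (x ∷ xs) =
    trans (cong ((f x ℚ.+ g x) ℚ.+_) (sumOver-+ f g xs)) (+-interchange (f x) (g x) _ _)

  sumOver-* : ∀ q f xs → sumOver (λ x → q ℚ.* f x) xs ≡ q ℚ.* sumOver f xs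
  sumOver-* q f []       = sym (ℚ.*-zeroʳ q)
  sumOver-* q f (x ∷ xs) =
    trans (cong (q ℚ.* f x ℚ.+_) (sumOver-* q f xs)) (sym (ℚ.*-distribˡ-+ q (f x) _))

  restrict-yes : ∀ {P : Pred A 0ℓ} (P? : Decidable P) f {x} → P x → restrict P? f x ≡ f x
  restrict-yes P? f {x} px with P? x
  ... | yes _  = refl
  ... | no ¬px = contradiction px ¬px

  restrict-no : ∀ {P : Pred A 0ℓ} (P? : Decidable P) f {x} → ¬ P x → restrict P? f x ≡ 0ℚ
  restrict-no P? f {x} ¬px with P? x
  ... | yes px = contradiction px ¬px
  ... | no _   = refl

  restrict-nonNeg : ∀ {P : Pred A 0ℓ} (P? : Decidable P) f {x} → 0ℚ ≤ℚ f x → 0ℚ ≤ℚ restrict P? f x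
  restrict-nonNeg P? f {x} 0≤fx with P? x
  ... | yes _ = 0≤fx
  ... | no _  = ℚ.≤-refl

  restrict-≤ : ∀ {P : Pred A 0ℓ} (P? : Decidable P) f {x q} → 0ℚ ≤ℚ q → (P x → f x ≤ℚ q) →
               restrict P? f x ≤ℚ q
  restrict-≤ P? f {x} 0≤q fx≤q with P? x
  ... | yes px = fx≤q px
  ... | no _   = 0≤q

  sumOver-filter : ∀ {P : Pred A 0ℓ} (P? : Decidable P) f xs →
                   sumOver f (filter P? xs) ≡ sumOver (restrict P? f) xs
  sumOver-filter P? f []       = refl
  sumOver-filter P? f (x ∷ xs) with does (P? x)
  ... | true  = cong (f x ℚ.+_) (sumOver-filter P? f xs)
  ... | false = trans (sumOver-filter P? f xs) (sym (ℚ.+-identityˡ _))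

  -- Union bound. The elements with `Q b` for the first `b` weigh at most `c`; the elements of `P`
  -- outside `Q b` are covered by the later entries, so the induction replaces `P` by that
  -- difference.
  sumOver-cover : ∀ {B : Set} {P : Pred A 0ℓ} (P? : Decidable P)
                  {Q : B → Pred A 0ℓ} (Q? : ∀ b → Decidable (Q b)) {f xs c} bs →
                  (∀ {x} → x ∈ xs → 0ℚ ≤ℚ f x) →
                  (∀ {x} → x ∈ xs → P x → Any (λ b → Q b x) bs) →
                  All (λ b → sumOver (restrict (Q? b) f) xs ≤ℚ c) bs →
                  sumOver (restrict P? f) xs ≤ℚ length bs · c
  sumOver-cover P? Q? {f} {xs} [] 0≤f cover [] =
    subst (sumOver (restrict P? f) xs ≤ℚ_) (sumOver-0 xs) (sumOver-mono xs λ x∈xs →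
      ℚ.≤-reflexive (restrict-no P? f λ px → ¬Any[] (cover x∈xs px)))
  sumOver-cover {P = P} P? {Q} Q? {f} {xs} {c} (b ∷ bs) 0≤f cover (b≤c ∷ bs≤c) = begin
    sumOver (restrict P? f) xs
      ≤⟨ sumOver-mono xs split ⟩
    sumOver (λ x → restrict (Q? b) f x ℚ.+ restrict P∖Q? f x) xs
      ≡⟨ sumOver-+ (restrict (Q? b) f) (restrict P∖Q? f) xs ⟩
    sumOver (restrict (Q? b) f) xs ℚ.+ sumOver (restrict P∖Q? f) xs
      ≤⟨ ℚ.+-mono-≤ b≤c (sumOver-cover P∖Q? Q? bs 0≤f rest bs≤c) ⟩
    c ℚ.+ length bs · c ∎
    where
    open ℚ.≤-Reasoning
    P∖Q? = λ x → P? x ×-dec ¬? (Q? b x)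
    split : ∀ {x} → x ∈ xs → restrict P? f x ≤ℚ restrict (Q? b) f x ℚ.+ restrict P∖Q? f x
    split {x} x∈xs with P? x | Q? b x
    ... | yes _ | yes _ = ℚ.≤-reflexive (sym (ℚ.+-identityʳ _))
    ... | yes _ | no _  = ℚ.≤-reflexive (sym (ℚ.+-identityˡ _))
    ... | no _  | yes _ = subst (0ℚ ≤ℚ_) (sym (ℚ.+-identityʳ _)) (0≤f x∈xs)
    ... | no _  | no _  = ℚ.≤-refl
    rest : ∀ {x} → x ∈ xs → P x × ¬ Q b x → Any (λ b → Q b x) bs
    rest x∈xs (px , ¬qx) with cover x∈xs px
    ... | here qx = contradiction qx ¬qx
    ... | there q = q

-- Natural multiples and reciprocals of rationals.

·-nonNeg : ∀ n {q} → 0ℚ ≤ℚ q → 0ℚ ≤ℚ n · q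
·-nonNeg zero    0≤q = ℚ.≤-refl
·-nonNeg (suc n) 0≤q = ℚ.+-mono-≤ 0≤q (·-nonNeg n 0≤q)

·-monoˡ-≤ : ∀ {m n q} → 0ℚ ≤ℚ q → m ≤ n → m · q ≤ℚ n · q
·-monoˡ-≤ {n = n} 0≤q z≤n       = ·-nonNeg n 0≤q
·-monoˡ-≤ {q = q} 0≤q (s≤s m≤n) = ℚ.+-monoʳ-≤ q (·-monoˡ-≤ 0≤q m≤n)

·-monoʳ-≤ : ∀ n {p q} → p ≤ℚ q → n · p ≤ℚ n · q
·-monoʳ-≤ zero    p≤q = ℚ.≤-refl
·-monoʳ-≤ (suc n) p≤q = ℚ.+-mono-≤ p≤q (·-monoʳ-≤ n p≤q)

-- Addition of rationals normalises and so hides the numerators; over unnormalised fractions the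
-- induction step is a cross multiplication.
·-/ : ∀ n m → n · (+ 1 ℚ./ suc m) ≡ + n ℚ./ suc m
·-/ zero    m = sym (ℚ.0/n≡0 (suc m))
·-/ (suc n) m = begin
  + 1 ℚ./ suc m ℚ.+ n · (+ 1 ℚ./ suc m)  ≡⟨ cong (+ 1 ℚ./ suc m ℚ.+_) (·-/ n m) ⟩
  + 1 ℚ./ suc m ℚ.+ + n ℚ./ suc m        ≡⟨ ℚ.toℚᵘ-injective sum≃ ⟩
  + suc n ℚ./ suc m                      ∎
  where
  open ≡-Reasoning
  un : ∀ i → ℚ.toℚᵘ (i ℚ./ suc m) ℚᵘ.≃ mkℚᵘ i m
  un i = ℚ.toℚᵘ-fromℚᵘ (mkℚᵘ i m)
  sum≃ : ℚ.toℚᵘ (+ 1 ℚ./ suc m ℚ.+ + n ℚ./ suc m) ℚᵘ.≃ ℚ.toℚᵘ (+ suc n ℚ./ suc m)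
  sum≃ = ℚᵘ.≃-trans (ℚ.toℚᵘ-homo-+ (+ 1 ℚ./ suc m) (+ n ℚ./ suc m))
        (ℚᵘ.≃-trans (ℚᵘ.+-cong (un (+ 1)) (un (+ n)))
        (ℚᵘ.≃-trans (*≡* (trans (cong (ℤ._* + suc m) (sym (ℤ.*-distribʳ-+ (+ suc m) (+ 1) (+ n))))
                                (ℤ.*-assoc (+ suc n) (+ suc m) (+ suc m))))
                    (ℚᵘ.≃-sym (un (+ suc n)))))

·-inv : ∀ n .{{_ : NonZero n}} q → n · (inv n ℚ.* q) ≡ q
·-inv (suc n) q = begin
  suc n · (inv (suc n) ℚ.* q)    ≡⟨ sym (·-assoc-* (suc n) (inv (suc n)) q) ⟩
  (suc n · inv (suc n)) ℚ.* q    ≡⟨ cong (ℚ._* q) (trans (·-/ (suc n) n) n/n≡1) ⟩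
  1ℚ ℚ.* q                       ≡⟨ ℚ.*-identityˡ q ⟩
  q                              ∎
  where
  open ≡-Reasoning
  n/n≡1 : + suc n ℚ./ suc n ≡ 1ℚ
  n/n≡1 = ℚ.fromℚᵘ-cong {mkℚᵘ (+ suc n) n} {mkℚᵘ (+ 1) 0} (*≡* (ℤ.*-comm (+ suc n) (+ 1)))

*-nonNeg : ∀ {p q} → 0ℚ ≤ℚ p → 0ℚ ≤ℚ q → 0ℚ ≤ℚ p ℚ.* q
*-nonNeg {p} {q} 0≤p 0≤q = ℚ.nonNegative⁻¹ (p ℚ.* q)
  {{ℚ.nonNeg*nonNeg⇒nonNeg p {{ℚ.nonNegative 0≤p}} q {{ℚ.nonNegative 0≤q}}}}

^-nonNeg : ∀ {q} n → 0ℚ ≤ℚ q → 0ℚ ≤ℚ q ^ℚ n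
^-nonNeg zero    0≤q = ℚ.nonNegative⁻¹ 1ℚ
^-nonNeg (suc n) 0≤q = *-nonNeg 0≤q (^-nonNeg n 0≤q)

inv-nonNeg : ∀ n → 0ℚ ≤ℚ inv n
inv-nonNeg zero    = ℚ.≤-refl
inv-nonNeg (suc n) = ℚ.nonNegative⁻¹ (inv (suc n)) {{ℚ.normalize-nonNeg 1 (suc n)}}

-- Sizes, intersections and differences of finite sets.

∣p∣≡∣p∩q∣+∣p─q∣ : ∀ {n} (p q : Subset n) → ∣ p ∣ ≡ ∣ p ∩ q ∣ ℕ.+ ∣ p ─ q ∣
∣p∣≡∣p∩q∣+∣p─q∣ []          []          = refl
∣p∣≡∣p∩q∣+∣p─q∣ (false ∷ p) (false ∷ q) = ∣p∣≡∣p∩q∣+∣p─q∣ p q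
∣p∣≡∣p∩q∣+∣p─q∣ (false ∷ p) (true ∷ q)  = ∣p∣≡∣p∩q∣+∣p─q∣ p q
∣p∣≡∣p∩q∣+∣p─q∣ (true ∷ p)  (false ∷ q) =
  trans (cong suc (∣p∣≡∣p∩q∣+∣p─q∣ p q)) (sym (ℕ.+-suc _ _))
∣p∣≡∣p∩q∣+∣p─q∣ (true ∷ p)  (true ∷ q)  = cong suc (∣p∣≡∣p∩q∣+∣p─q∣ p q)

∣⁅x⁆∪p∣≡1+∣p∣ : ∀ {n} {x : Fin n} {p} → x ∉ˢ p → ∣ ⁅ x ⁆ ∪ p ∣ ≡ suc ∣ p ∣
∣⁅x⁆∪p∣≡1+∣p∣ {x = zero}  {false ∷ p} x∉p = cong (suc ∘ ∣_∣) (∪-identityˡ p)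
∣⁅x⁆∪p∣≡1+∣p∣ {x = zero}  {true ∷ p}  x∉p = contradiction here x∉p
∣⁅x⁆∪p∣≡1+∣p∣ {x = suc x} {false ∷ p} x∉p = ∣⁅x⁆∪p∣≡1+∣p∣ (x∉p ∘ there)
∣⁅x⁆∪p∣≡1+∣p∣ {x = suc x} {true ∷ p}  x∉p = cong suc (∣⁅x⁆∪p∣≡1+∣p∣ (x∉p ∘ there))

∣p∣≤1+∣p-x∣ : ∀ {n} (p : Subset n) x → ∣ p ∣ ≤ suc ∣ p - x ∣
∣p∣≤1+∣p-x∣ p x = begin
  ∣ p ∣                           ≡⟨ ∣p∣≡∣p∩q∣+∣p─q∣ p ⁅ x ⁆ ⟩
  ∣ p ∩ ⁅ x ⁆ ∣ ℕ.+ ∣ p - x ∣    ≤⟨ ℕ.+-monoˡ-≤ ∣ p - x ∣ (∣p∩q∣≤∣q∣ p ⁅ x ⁆) ⟩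
  ∣ ⁅ x ⁆ ∣ ℕ.+ ∣ p - x ∣        ≡⟨ cong (ℕ._+ ∣ p - x ∣) (∣⁅x⁆∣≡1 x) ⟩
  suc ∣ p - x ∣                  ∎
  where open ℕ.≤-Reasoning

x∈p─q⇒x∉q : ∀ {n} {x : Fin n} {p q} → x ∈ˢ p ─ q → x ∉ˢ q
x∈p─q⇒x∉q {p = _ ∷ _} {false ∷ _} here      ()
x∈p─q⇒x∉q {p = _ ∷ p} {true ∷ q}  (there h) (there h′) = x∈p─q⇒x∉q {p = p} {q} h h′
x∈p─q⇒x∉q {p = _ ∷ p} {false ∷ q} (there h) (there h′) = x∈p─q⇒x∉q {p = p} {q} h h′

⁅x⁆⊆p : ∀ {n} {x : Fin n} {p} → x ∈ˢ p → ⁅ x ⁆ ⊆ p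
⁅x⁆⊆p {x = x} x∈p y∈⁅x⁆ with x∈⁅y⁆⇒x≡y x y∈⁅x⁆
... | refl = x∈p

x∈p⇒0<∣p∣ : ∀ {n} {x : Fin n} {p} → x ∈ˢ p → 0 ℕ.< ∣ p ∣
x∈p⇒0<∣p∣ {x = x} x∈p = subst (_≤ _) (∣⁅x⁆∣≡1 x) (p⊆q⇒∣p∣≤∣q∣ (⁅x⁆⊆p x∈p))

∣p∣≡0⇒p≡⊥ : ∀ {n} {p : Subset n} → ∣ p ∣ ≡ 0 → p ≡ ⊥
∣p∣≡0⇒p≡⊥ ∣p∣≡0 = Empty-unique λ (_ , x∈p) → ℕ.<⇒≢ (x∈p⇒0<∣p∣ x∈p) (sym ∣p∣≡0)

0<∣p∣⇒Nonempty : ∀ {n} {p : Subset n} → 0 ℕ.< ∣ p ∣ → Nonempty p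
0<∣p∣⇒Nonempty {n} {p} 0<∣p∣ with nonempty? p
... | yes ne = ne
... | no  em = contradiction (sym (trans (cong ∣_∣ (Empty-unique em)) (∣⊥∣≡0 n))) (ℕ.<⇒≢ 0<∣p∣)

p⊆q⇒q∩p≡p : ∀ {n} {p q : Subset n} → p ⊆ q → q ∩ p ≡ p
p⊆q⇒q∩p≡p {p = p} {q} p⊆q = ⊆-antisym (p∩q⊆q q p) λ x∈p → x∈p∩q⁺ (p⊆q x∈p , x∈p)

p∩q≡⊥⇒p─q≡p : ∀ {n} {p q : Subset n} → Empty (p ∩ q) → p ─ q ≡ p
p∩q≡⊥⇒p─q≡p {p = p} {q} p∩q≡∅ = ⊆-antisym (p─q⊆p p q) λ x∈p →
  x∈p∧x∉q⇒x∈p─q x∈p λ x∈q → p∩q≡∅ (_ , x∈p∩q⁺ (x∈p , x∈q))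

p⊆q⇒p∪[q─p]≡q : ∀ {n} {p q : Subset n} → p ⊆ q → p ∪ (q ─ p) ≡ q
p⊆q⇒p∪[q─p]≡q {p = p} {q} p⊆q = ⊆-antisym
  ([ p⊆q , p─q⊆p q p ]′ ∘ x∈p∪q⁻ p (q ─ p)) q⊆
  where
  q⊆ : q ⊆ p ∪ (q ─ p)
  q⊆ {x} x∈q with x ∈? p
  ... | yes x∈p = x∈p∪q⁺ (inj₁ x∈p)
  ... | no  x∉p = x∈p∪q⁺ (inj₂ (x∈p∧x∉q⇒x∈p─q x∈q x∉p))

─-mono-⊆ : ∀ {n} {p q : Subset n} r → p ⊆ q → p ─ r ⊆ q ─ r
─-mono-⊆ {p = p} {q} r p⊆q x∈p─r =
  x∈p∧x∉q⇒x∈p─q (p⊆q (p─q⊆p p r x∈p─r)) (x∈p─q⇒x∉q {p = p} {r} x∈p─r)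

∩-─-distrib : ∀ {n} (p q r : Subset n) → (p ─ r) ∩ (q ─ r) ≡ (p ∩ q) ─ r
∩-─-distrib p q r = ⊆-antisym to from
  where
  to : (p ─ r) ∩ (q ─ r) ⊆ (p ∩ q) ─ r
  to x∈ with x∈p∩q⁻ (p ─ r) (q ─ r) x∈
  ... | x∈p , x∈q = x∈p∧x∉q⇒x∈p─q
    (x∈p∩q⁺ (p─q⊆p p r x∈p , p─q⊆p q r x∈q)) (x∈p─q⇒x∉q {p = p} {r} x∈p)
  from : (p ∩ q) ─ r ⊆ (p ─ r) ∩ (q ─ r)
  from x∈ = x∈p∩q⁺ (─-mono-⊆ r (p∩q⊆p p q) x∈ , ─-mono-⊆ r (p∩q⊆q p q) x∈)

-- Subsets of prescribed size and binomial coefficients.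

∃⊆-ofSize : ∀ {n} (p : Subset n) {j} → j ≤ ∣ p ∣ → ∃ λ q → q ⊆ p × ∣ q ∣ ≡ j
∃⊆-ofSize {n} p       {zero}  _         = ⊥ , ⊆-min p , ∣⊥∣≡0 n
∃⊆-ofSize (false ∷ p) {suc j} j<        with ∃⊆-ofSize p j<
... | q , q⊆p , ∣q∣ = false ∷ q , s⊆s q⊆p , ∣q∣
∃⊆-ofSize (true ∷ p)  {suc j} (s≤s j≤)  with ∃⊆-ofSize p j≤
... | q , q⊆p , ∣q∣ = true ∷ q , s⊆s q⊆p , cong suc ∣q∣

subsetsOfSize : ∀ {n} → ℕ → Subset n → List (Subset n)
subsetsOfSize zero    p           = ⊥ ∷ []
subsetsOfSize (suc j) []          = []
subsetsOfSize (suc j) (false ∷ p) = map (false ∷_) (subsetsOfSize (suc j) p)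
subsetsOfSize (suc j) (true ∷ p)  =
  map (true ∷_) (subsetsOfSize j p) ++ map (false ∷_) (subsetsOfSize (suc j) p)

nC0≡1 : ∀ n → n C 0 ≡ 1
nC0≡1 n = trans (nCk≡nC[n∸k] {0} {n} z≤n) (nCn≡1 n)

-- Whether the first point is taken splits the subsets into two lists, which is Pascal's rule.
length-subsetsOfSize : ∀ {n} j (p : Subset n) → length (subsetsOfSize j p) ≡ ∣ p ∣ C j
length-subsetsOfSize zero    p           = sym (nC0≡1 ∣ p ∣)
length-subsetsOfSize (suc j) []          = sym (k>n⇒nCk≡0 {0} {suc j} (s≤s z≤n))
length-subsetsOfSize (suc j) (false ∷ p) =
  trans (length-map _ (subsetsOfSize (suc j) p)) (length-subsetsOfSize (suc j) p)
length-subsetsOfSize (suc j) (true ∷ p)  = begin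
  length (map (true ∷_) (subsetsOfSize j p) ++ map (false ∷_) (subsetsOfSize (suc j) p))
    ≡⟨ length-++ (map (true ∷_) (subsetsOfSize j p)) ⟩
  length (map (true ∷_) (subsetsOfSize j p)) ℕ.+ length (map (false ∷_) (subsetsOfSize (suc j) p))
    ≡⟨ cong₂ ℕ._+_ (length-map _ (subsetsOfSize j p)) (length-map _ (subsetsOfSize (suc j) p)) ⟩
  length (subsetsOfSize j p) ℕ.+ length (subsetsOfSize (suc j) p)
    ≡⟨ cong₂ ℕ._+_ (length-subsetsOfSize j p) (length-subsetsOfSize (suc j) p) ⟩
  ∣ p ∣ C j ℕ.+ ∣ p ∣ C suc j
    ≡⟨ nCk+nC[k+1]≡[n+1]C[k+1] ∣ p ∣ j ⟩
  suc ∣ p ∣ C suc j ∎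
  where open ≡-Reasoning

∈-subsetsOfSize⁺ : ∀ {n} {q : Subset n} j {p} → q ⊆ p → ∣ q ∣ ≡ j → q ∈ subsetsOfSize j p
∈-subsetsOfSize⁺                 zero               q⊆p ∣q∣ = here (∣p∣≡0⇒p≡⊥ ∣q∣)
∈-subsetsOfSize⁺ {q = []}        (suc j) {[]}        q⊆p ()
∈-subsetsOfSize⁺ {q = true ∷ q}  (suc j) {false ∷ p} q⊆p ∣q∣ with () ← q⊆p here
∈-subsetsOfSize⁺ {q = false ∷ q} (suc j) {false ∷ p} q⊆p ∣q∣ =
  ∈-map⁺ (false ∷_) (∈-subsetsOfSize⁺ (suc j) (drop-∷-⊆ q⊆p) ∣q∣)
∈-subsetsOfSize⁺ {q = true ∷ q}  (suc j) {true ∷ p}  q⊆p ∣q∣ =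
  ∈-++⁺ˡ (∈-map⁺ (true ∷_) (∈-subsetsOfSize⁺ j (drop-∷-⊆ q⊆p) (ℕ.suc-injective ∣q∣)))
∈-subsetsOfSize⁺ {q = false ∷ q} (suc j) {true ∷ p}  q⊆p ∣q∣ =
  ∈-++⁺ʳ _ (∈-map⁺ (false ∷_) (∈-subsetsOfSize⁺ (suc j) (drop-∷-⊆ q⊆p) ∣q∣))

∈-subsetsOfSize⁻ : ∀ {n} {q : Subset n} j p → q ∈ subsetsOfSize j p → q ⊆ p × ∣ q ∣ ≡ j
∈-subsetsOfSize⁻ {n} zero    p           (here refl) = ⊆-min p , ∣⊥∣≡0 n
∈-subsetsOfSize⁻     (suc j) (false ∷ p) q∈ with ∈-map⁻ (false ∷_) q∈
... | q , q∈′ , refl with ∈-subsetsOfSize⁻ (suc j) p q∈′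
... | q⊆p , ∣q∣ = s⊆s q⊆p , ∣q∣
∈-subsetsOfSize⁻     (suc j) (true ∷ p)  q∈ with ∈-++⁻ (map (true ∷_) (subsetsOfSize j p)) q∈
... | inj₁ q∈₁ with ∈-map⁻ (true ∷_) q∈₁
...   | q , q∈′ , refl with ∈-subsetsOfSize⁻ j p q∈′
...   | q⊆p , ∣q∣ = s⊆s q⊆p , cong suc ∣q∣
∈-subsetsOfSize⁻     (suc j) (true ∷ p)  q∈ | inj₂ q∈₂ with ∈-map⁻ (false ∷_) q∈₂
...   | q , q∈′ , refl with ∈-subsetsOfSize⁻ (suc j) p q∈′
...   | q⊆p , ∣q∣ = out⊆ q⊆p , ∣q∣

elements : ∀ {n} → Subset n → List (Fin n)
elements []          = []
elements (true ∷ p)  = zero ∷ map suc (elements p)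
elements (false ∷ p) = map suc (elements p)

length-elements : ∀ {n} (p : Subset n) → length (elements p) ≡ ∣ p ∣
length-elements []          = refl
length-elements (true ∷ p)  = cong suc (trans (length-map suc (elements p)) (length-elements p))
length-elements (false ∷ p) = trans (length-map suc (elements p)) (length-elements p)

∈-elements⁺ : ∀ {n} {x : Fin n} {p} → x ∈ˢ p → x ∈ elements p
∈-elements⁺ {p = true ∷ p}  here        = here refl
∈-elements⁺ {p = true ∷ p}  (there x∈p) = there (∈-map⁺ suc (∈-elements⁺ x∈p))
∈-elements⁺ {p = false ∷ p} (there x∈p) = ∈-map⁺ suc (∈-elements⁺ x∈p)

-- Pascal's rule compares consecutive upper indices, except at lower index 0, where both sides are
-- 1.
C-monoˡ-≤ : ∀ {m n} k → m ≤ n → m C k ≤ n C k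
C-monoˡ-≤ {m} k m≤n = go (ℕ.≤⇒≤′ m≤n)
  where
  step : ∀ n j → n C j ≤ suc n C j
  step n zero    = ℕ.≤-reflexive (trans (nC0≡1 n) (sym (nC0≡1 (suc n))))
  step n (suc j) = subst (n C suc j ≤_) (nCk+nC[k+1]≡[n+1]C[k+1] n j) (ℕ.m≤n+m _ _)
  go : ∀ {n} → m ℕ.≤′ n → m C k ≤ n C k
  go (ℕ.≤′-reflexive refl) = ℕ.≤-refl
  go (ℕ.≤′-step m≤′n)      = ℕ.≤-trans (go m≤′n) (step _ k)

k≤n⇒0<nCk : ∀ {k n} → k ≤ n → 0 ℕ.< n C k
k≤n⇒0<nCk {k} {n} k≤n = subst (_≤ n C k) (nCn≡1 k) (C-monoˡ-≤ k k≤n)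

-- List bounds and maximal families of unrelated elements.

length-concatMap-≤ : ∀ {A B : Set} (f : A → List B) {b} xs →
                     (∀ {x} → x ∈ xs → length (f x) ≤ b) →
                     length (concatMap f xs) ≤ length xs ℕ.* b
length-concatMap-≤ f []       f≤b = z≤n
length-concatMap-≤ f (x ∷ xs) f≤b = subst (_≤ _) (sym (length-++ (f x)))
  (ℕ.+-mono-≤ (f≤b (here refl)) (length-concatMap-≤ f xs (f≤b ∘ there)))

-- `AllPairs` relates earlier entries to later ones only; symmetry supplies the reverse order.
AllPairs-lookup : ∀ {A : Set} {R : Rel A 0ℓ} → Symmetric R → ∀ {xs} → AllPairs R xs →
                  ∀ {i j} → i ≢ j → R (lookup xs i) (lookup xs j)
AllPairs-lookup R-sym (_ ∷ _)   {zero}  {zero}  i≢j = contradiction refl i≢j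
AllPairs-lookup R-sym (px ∷ _)  {zero}  {suc j} i≢j = All.lookup px (∈-lookup j)
AllPairs-lookup R-sym (px ∷ _)  {suc i} {zero}  i≢j = R-sym (All.lookup px (∈-lookup i))
AllPairs-lookup R-sym (_ ∷ pxs) {suc i} {suc j} i≢j = AllPairs-lookup R-sym pxs (i≢j ∘ cong suc)

module _ {A : Set} {_~_ : Rel A 0ℓ} (_~?_ : Decidable₂ _~_) where

  -- Greedy choice from the end of the list: an element is added when it is related to none of those
  -- chosen, and otherwise one of them dominates it. Reflexivity lets an added element dominate
  -- itself.
  maximalClique : ∀ xs → (∀ {x} → x ∈ xs → x ~ x) →
    ∃ λ ys → (∀ {y} → y ∈ ys → y ∈ xs) × AllPairs (λ x y → ¬ x ~ y) ys ×
      (∀ {x} → x ∈ xs → Any (x ~_) ys)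
  maximalClique []       ~-refl = [] , id , [] , λ ()
  maximalClique (x ∷ xs) ~-refl with maximalClique xs (~-refl ∘ there)
  ... | ys , ys⊆xs , clique , dominated with All.all? (λ y → ¬? (x ~? y)) ys
  ... | yes x≁ys =
    x ∷ ys ,
    (λ { (here y≡x) → here y≡x ; (there y∈ys) → there (ys⊆xs y∈ys) }) ,
    x≁ys ∷ clique ,
    λ { (here refl) → here (~-refl (here refl)) ; (there z∈xs) → there (dominated z∈xs) }
  ... | no ¬x≁ys =
    ys , there ∘ ys⊆xs , clique ,
    λ { (here refl)  → Any.map (decidable-stable (x ~? _)) (¬All⇒Any¬ (λ y → ¬? (x ~? y)) ys ¬x≁ys)
      ; (there z∈xs) → dominated z∈xs }

-- Sets that contain a block or avoid it.

_meets?_ : ∀ {n} (p q : Subset n) → Dec (Nonempty (p ∩ q))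
p meets? q = nonempty? (p ∩ q)

-- A union of disjoint blocks, `D` among them, has this property; it is the criterion for keeping a
-- member once `D` is chosen.
Respects : ∀ {n} → Subset n → Subset n → Set
Respects D p = D ⊆ p ⊎ Empty (p ∩ D)

respects? : ∀ {n} (D p : Subset n) → Dec (Respects D p)
respects? D p = (D ⊆? p) ⊎-dec ¬? (p meets? D)

-- `p ∩ q` contains `D` if both sets do and avoids it otherwise, so removing `D` lowers the size of
-- the intersection by `∣ D ∣` or by 0.
∣-∩-─ : ∀ {n} {D p q : Subset n} → Respects D p → Respects D q →
        ∣ D ∣ ∣ ∣ p ∩ q ∣ → ∣ D ∣ ∣ ∣ (p ─ D) ∩ (q ─ D) ∣
∣-∩-─ {n} {D} {p} {q} Dp Dq D∣p∩q = subst (λ s → ∣ D ∣ ∣ ∣ s ∣) (sym (∩-─-distrib p q D))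
  (∣m+n∣m⇒∣n (subst (∣ D ∣ ∣_) (∣p∣≡∣p∩q∣+∣p─q∣ (p ∩ q) D) D∣p∩q) (divides∩ Dp Dq))
  where
  empty : Empty ((p ∩ q) ∩ D) → ∣ D ∣ ∣ ∣ (p ∩ q) ∩ D ∣
  empty em = subst (∣ D ∣ ∣_) (sym (trans (cong ∣_∣ (Empty-unique em)) (∣⊥∣≡0 n))) (∣ D ∣ ∣0)
  divides∩ : Respects D p → Respects D q → ∣ D ∣ ∣ ∣ (p ∩ q) ∩ D ∣
  divides∩ (inj₁ D⊆p) (inj₁ D⊆q) =
    ∣-reflexive (cong ∣_∣ (sym (p⊆q⇒q∩p≡p λ x∈D → x∈p∩q⁺ (D⊆p x∈D , D⊆q x∈D))))
  divides∩ (inj₂ p∩D) _ = empty λ (x , x∈) →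
    let x∈p∩q , x∈D = x∈p∩q⁻ (p ∩ q) D x∈ in p∩D (x , x∈p∩q⁺ (p∩q⊆p p q x∈p∩q , x∈D))
  divides∩ _ (inj₂ q∩D) = empty λ (x , x∈) →
    let x∈p∩q , x∈D = x∈p∩q⁻ (p ∩ q) D x∈ in q∩D (x , x∈p∩q⁺ (p∩q⊆q p q x∈p∩q , x∈D))

-- `D` is selected in the case `D ⊆ p`; in the other case `p ─ D` is `p` itself and the old
-- selection serves.
IsUnionOf-cons : ∀ {N n} (D : Subset N) (Xs : Fin n → Subset N) {p} → Respects D p →
                 IsUnionOf Xs (p ─ D) → IsUnionOf (D Vector.∷ Xs) p
IsUnionOf-cons D Xs (inj₁ D⊆p)   (s , eq) = true ∷ s , trans (sym (p⊆q⇒p∪[q─p]≡q D⊆p)) (cong (D ∪_) eq)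
IsUnionOf-cons D Xs (inj₂ p∩D≡∅) (s , eq) =
  false ∷ s , trans (sym (p∩q≡⊥⇒p─q≡p p∩D≡∅)) (trans eq (sym (∪-identityˡ (unionSel Xs s))))

-- Traces of members and their weights.

module _ {A : Set} {_~_ : Rel A 0ℓ} (_~?_ : Decidable₂ _~_) (w : A → ℚ)
         (k e m : ℕ) .{{_ : NonZero (suc e ℕ.* (k C e) ℕ.* m)}} {N : ℕ} where

  private
    -- With block size `suc e`, the coefficient C(k, d-1) is `k C e`.
    d = suc e
    M = d ℕ.* (k C e) ℕ.* m

  block-nonempty : ∀ {D : Subset N} → ∣ D ∣ ≡ d → Nonempty D
  block-nonempty ∣D∣≡d = 0<∣p∣⇒Nonempty (subst (0 ℕ.<_) (sym ∣D∣≡d) (s≤s z≤n))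

  -- r x is what remains of the member x once the blocks chosen so far, which are
  -- disjoint from V, have been removed from it; _~_ stays that of the original members.
  record Trace (xs : List A) (V : Subset N) (r : A → Subset N) : Set where
    field
      trace⊆   : ∀ {x} → x ∈ xs → r x ⊆ V
      trace≤k  : ∀ {x} → x ∈ xs → ∣ r x ∣ ≤ k
      ~-refl   : ∀ {x} → x ∈ xs → x ~ x
      ~⇒∣      : ∀ {x y} → x ∈ xs → y ∈ xs → x ~ y → d ∣ ∣ r x ∩ r y ∣
      clique<m : ∀ ys → (∀ {y} → y ∈ ys → y ∈ xs) → AllPairs (λ x y → ¬ x ~ y) ys → length ys ℕ.< m
      w-nonNeg : ∀ {x} → x ∈ xs → 0ℚ ≤ℚ w x

    -- The diagonal case of `~⇒∣`, available because `~` is reflexive on members.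
    d∣trace : ∀ {x} → x ∈ xs → d ∣ ∣ r x ∣
    d∣trace {x} x∈xs = subst (λ p → d ∣ ∣ p ∣) (∩-idem (r x)) (~⇒∣ x∈xs x∈xs (~-refl x∈xs))

  open Trace

  -- The exponent follows the current trace while `w x` stays that of the original member, so each
  -- block removed from `x` multiplies its weight by `M`.
  weight : (A → Subset N) → A → ℚ
  weight r x = (inv M ^ℚ (∣ r x ∣ ℕ./ d)) ℚ.* w x

  -- Candidate blocks, and covers of the members by few of them.

  candidates : List A → (A → Subset N) → List (Subset N)
  candidates xs r = concatMap (subsetsOfSize d ∘ r) xs

  ∈-candidates⁺ : ∀ {xs} r {D x} → x ∈ xs → D ⊆ r x → ∣ D ∣ ≡ d → D ∈ candidates xs r
  ∈-candidates⁺ r x∈xs D⊆rx ∣D∣≡d =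
    ∈-concatMap⁺ (subsetsOfSize d ∘ r) (Any.map (λ { refl → ∈-subsetsOfSize⁺ d D⊆rx ∣D∣≡d }) x∈xs)

  ∈-candidates⁻ : ∀ xs r {D} → D ∈ candidates xs r → ∃ λ x → x ∈ xs × D ⊆ r x × ∣ D ∣ ≡ d
  ∈-candidates⁻ xs r D∈ with find (∈-concatMap⁻ (subsetsOfSize d ∘ r) {xs = xs} D∈)
  ... | x , x∈xs , D∈′ = x , x∈xs , ∈-subsetsOfSize⁻ d (r x) D∈′

  -- Each `y` in a maximal family of pairwise unrelated members through `i` contributes the d-sets
  -- `⁅ i ⁆ ∪ E` with `E` an `e`-subset of `r y - i`. A member through `i` is related to some such
  -- `y`, and their intersection is large enough to contain one of these sets.
  blocksThrough : ∀ {xs V r} → Trace xs V r → ∀ i → ∃ λ Ds →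
    length Ds ≤ (k C e) ℕ.* m ×
    (∀ {D} → D ∈ Ds → D ∈ candidates xs r) ×
    (∀ {x} → x ∈ xs → i ∈ˢ r x → Any (_⊆ r x) Ds)
  blocksThrough {xs} {V} {r} T i
    with ys , ys⊆ , clique , dominated ←
           maximalClique _~?_ (filter (λ x → i ∈? r x) xs) (~-refl T ∘ proj₁ ∘ ∈-filter⁻ (λ x → i ∈? r x))
    = concatMap blocks ys , length≤ , sound , complete
    where
    i∈r? : ∀ x → Dec (i ∈ˢ r x)
    i∈r? x = i ∈? r x
    blocks : A → List (Subset N)
    blocks y = map (⁅ i ⁆ ∪_) (subsetsOfSize e (r y - i))
    ys⊆xs : ∀ {y} → y ∈ ys → y ∈ xs
    ys⊆xs = proj₁ ∘ ∈-filter⁻ i∈r? ∘ ys⊆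
    i∈r : ∀ {y} → y ∈ ys → i ∈ˢ r y
    i∈r = proj₂ ∘ ∈-filter⁻ i∈r? {xs = xs} ∘ ys⊆
    i∉ : ∀ {E p} → E ⊆ p - i → i ∉ˢ E
    i∉ {p = p} E⊆ i∈E = x∈p─q⇒x∉q {p = p} {⁅ i ⁆} (E⊆ i∈E) (x∈⁅x⁆ i)

    length-blocks≤ : ∀ {y} → y ∈ ys → length (blocks y) ≤ k C e
    length-blocks≤ {y} y∈ys = begin
      length (blocks y)                   ≡⟨ length-map (⁅ i ⁆ ∪_) (subsetsOfSize e (r y - i)) ⟩
      length (subsetsOfSize e (r y - i))  ≡⟨ length-subsetsOfSize e (r y - i) ⟩
      ∣ r y - i ∣ C e                     ≤⟨ C-monoˡ-≤ e (∣p─q∣≤∣p∣ (r y) ⁅ i ⁆) ⟩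
      ∣ r y ∣ C e                         ≤⟨ C-monoˡ-≤ e (trace≤k T (ys⊆xs y∈ys)) ⟩
      k C e                               ∎
      where open ℕ.≤-Reasoning

    length≤ : length (concatMap blocks ys) ≤ (k C e) ℕ.* m
    length≤ = begin
      length (concatMap blocks ys)  ≤⟨ length-concatMap-≤ blocks ys length-blocks≤ ⟩
      length ys ℕ.* (k C e)         ≤⟨ ℕ.*-monoˡ-≤ (k C e) (ℕ.<⇒≤ (clique<m T ys ys⊆xs clique)) ⟩
      m ℕ.* (k C e)                 ≡⟨ ℕ.*-comm m (k C e) ⟩
      (k C e) ℕ.* m                 ∎
      where open ℕ.≤-Reasoning

    sound : ∀ {D} → D ∈ concatMap blocks ys → D ∈ candidates xs r
    sound D∈ with find (∈-concatMap⁻ blocks {xs = ys} D∈)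
    ... | y , y∈ys , D∈y with ∈-map⁻ (⁅ i ⁆ ∪_) D∈y
    ... | E , E∈ , refl with ∈-subsetsOfSize⁻ e (r y - i) E∈
    ... | E⊆ , ∣E∣≡e = ∈-candidates⁺ r (ys⊆xs y∈ys)
      ([ ⁅x⁆⊆p (i∈r y∈ys) , p─q⊆p (r y) ⁅ i ⁆ ∘ E⊆ ]′ ∘ x∈p∪q⁻ ⁅ i ⁆ E)
      (trans (∣⁅x⁆∪p∣≡1+∣p∣ (i∉ {p = r y} E⊆)) (cong suc ∣E∣≡e))

    complete : ∀ {x} → x ∈ xs → i ∈ˢ r x → Any (_⊆ r x) (concatMap blocks ys)
    complete {x} x∈xs i∈rx with find (dominated (∈-filter⁺ i∈r? x∈xs i∈rx))
    ... | y , y∈ys , x~y with ∃⊆-ofSize ((r x ∩ r y) - i) e≤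
      where
      i∈∩ : i ∈ˢ r x ∩ r y
      i∈∩ = x∈p∩q⁺ (i∈rx , i∈r y∈ys)
      -- The intersection contains `i`, so its size is a non-zero multiple of `d` and at least
      -- `suc e`; deleting `i` leaves at least `e` points.
      e≤ : e ≤ ∣ (r x ∩ r y) - i ∣
      e≤ = ℕ.s≤s⁻¹ (ℕ.≤-trans
        (∣⇒≤ {{ℕ.>-nonZero (x∈p⇒0<∣p∣ i∈∩)}} (~⇒∣ T x∈xs (ys⊆xs y∈ys) x~y))
        (∣p∣≤1+∣p-x∣ (r x ∩ r y) i))
    ... | E , E⊆ , ∣E∣≡e = lose
      (∈-concatMap⁺ blocks (Any.map (λ { refl → ∈-map⁺ (⁅ i ⁆ ∪_) (∈-subsetsOfSize⁺ e E⊆ry ∣E∣≡e) }) y∈ys))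
      ([ ⁅x⁆⊆p i∈rx , (λ z∈E → p∩q⊆p (r x) (r y) (p─q⊆p (r x ∩ r y) ⁅ i ⁆ (E⊆ z∈E))) ]′ ∘ x∈p∪q⁻ ⁅ i ⁆ E)
      where
      E⊆ry : E ⊆ r y - i
      E⊆ry = ─-mono-⊆ ⁅ i ⁆ (p∩q⊆q (r x) (r y)) ∘ E⊆

  -- A member that meets `D` passes through one of its `d` points; joining the lists for these
  -- points accounts for the factor `d` in `M`.
  blocksMeeting : ∀ {xs V r} → Trace xs V r → ∀ {D} → ∣ D ∣ ≡ d → ∃ λ Ds →
    length Ds ≤ M ×
    (∀ {D′} → D′ ∈ Ds → D′ ∈ candidates xs r) ×
    (∀ {x} → x ∈ xs → Nonempty (r x ∩ D) → Any (_⊆ r x) Ds)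
  blocksMeeting {xs} {V} {r} T {D} ∣D∣≡d = concatMap blocks (elements D) , length≤ , sound , complete
    where
    blocks : Fin N → List (Subset N)
    blocks = proj₁ ∘ blocksThrough T
    length≤ : length (concatMap blocks (elements D)) ≤ M
    length≤ = begin
      length (concatMap blocks (elements D))
        ≤⟨ length-concatMap-≤ blocks (elements D) (λ {i} _ → proj₁ (proj₂ (blocksThrough T i))) ⟩
      length (elements D) ℕ.* ((k C e) ℕ.* m)
        ≡⟨ cong (ℕ._* ((k C e) ℕ.* m)) (trans (length-elements D) ∣D∣≡d) ⟩
      d ℕ.* ((k C e) ℕ.* m)
        ≡⟨ sym (ℕ.*-assoc d (k C e) m) ⟩
      M ∎
      where open ℕ.≤-Reasoning
    sound : ∀ {D′} → D′ ∈ concatMap blocks (elements D) → D′ ∈ candidates xs r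
    sound D′∈ with find (∈-concatMap⁻ blocks {xs = elements D} D′∈)
    ... | i , _ , D′∈i = proj₁ (proj₂ (proj₂ (blocksThrough T i))) D′∈i
    complete : ∀ {x} → x ∈ xs → Nonempty (r x ∩ D) → Any (_⊆ r x) (concatMap blocks (elements D))
    complete {x} x∈xs (i , i∈) with x∈p∩q⁻ (r x) D i∈
    ... | i∈rx , i∈D with find (proj₂ (proj₂ (proj₂ (blocksThrough T i))) x∈xs i∈rx)
    ... | D′ , D′∈ , D′⊆rx = lose (∈-concatMap⁺ blocks (Any.map (λ { refl → D′∈ }) (∈-elements⁺ i∈D))) D′⊆rx

  -- Weights under the removal of a block.

  weight-nonNeg : ∀ {xs V r} → Trace xs V r → ∀ {x} → x ∈ xs → 0ℚ ≤ℚ weight r x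
  weight-nonNeg {r = r} T {x} x∈xs = *-nonNeg (^-nonNeg (∣ r x ∣ ℕ./ d) (inv-nonNeg M)) (w-nonNeg T x∈xs)

  weightOver : List A → (A → Subset N) → Subset N → ℚ
  weightOver xs r D = sumOver (restrict (λ x → D ⊆? r x) (weight r)) xs

  _without_ : (A → Subset N) → Subset N → A → Subset N
  (r without D) x = r x ─ D

  -- Removing `D` lowers the size by exactly `d`, hence the exponent by one.
  weight-⊆ : ∀ r x {D} → ∣ D ∣ ≡ d → D ⊆ r x → weight r x ≡ inv M ℚ.* weight (r without D) x
  weight-⊆ r x {D} ∣D∣≡d D⊆rx = begin
    (inv M ^ℚ (∣ r x ∣ ℕ./ d)) ℚ.* w x                    ≡⟨ cong (λ j → (inv M ^ℚ j) ℚ.* w x) quotient ⟩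
    (inv M ℚ.* (inv M ^ℚ (∣ r x ─ D ∣ ℕ./ d))) ℚ.* w x    ≡⟨ ℚ.*-assoc (inv M) _ (w x) ⟩
    inv M ℚ.* weight (r without D) x                       ∎
    where
    open ≡-Reasoning
    size : ∣ r x ∣ ≡ d ℕ.+ ∣ r x ─ D ∣
    size = trans (∣p∣≡∣p∩q∣+∣p─q∣ (r x) D)
      (cong (ℕ._+ ∣ r x ─ D ∣) (trans (cong ∣_∣ (p⊆q⇒q∩p≡p D⊆rx)) ∣D∣≡d))
    quotient : ∣ r x ∣ ℕ./ d ≡ suc (∣ r x ─ D ∣ ℕ./ d)
    quotient = begin
      ∣ r x ∣ ℕ./ d                              ≡⟨ cong (ℕ._/ d) size ⟩
      (d ℕ.+ ∣ r x ─ D ∣) ℕ./ d                  ≡⟨ m/n≡1+[m∸n]/n (ℕ.m≤m+n d ∣ r x ─ D ∣) ⟩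
      suc ((d ℕ.+ ∣ r x ─ D ∣ ℕ.∸ d) ℕ./ d)      ≡⟨ cong (λ j → suc (j ℕ./ d)) (ℕ.m+n∸m≡n d ∣ r x ─ D ∣) ⟩
      suc (∣ r x ─ D ∣ ℕ./ d)                    ∎

  weight-∩≡∅ : ∀ r x {D} → Empty (r x ∩ D) → weight r x ≡ weight (r without D) x
  weight-∩≡∅ r x r∩D = cong (λ p → (inv M ^ℚ (∣ p ∣ ℕ./ d)) ℚ.* w x) (sym (p∩q≡⊥⇒p─q≡p r∩D))

  -- Members avoiding `D` keep their weight. Those meeting `D` weigh at most `M` times those
  -- containing it, and this is exactly what the latter weigh after `D` is removed from them.
  weight-step : ∀ {xs V r} → Trace xs V r → ∀ {D} → ∣ D ∣ ≡ d →
    (∀ {D′} → D′ ∈ candidates xs r → weightOver xs r D′ ≤ℚ weightOver xs r D) →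
    sumOver (weight r) xs ≤ℚ sumOver (restrict (respects? D ∘ r) (weight (r without D))) xs
  weight-step {xs} {V} {r} T {D} ∣D∣≡d D-max = begin
    sumOver (weight r) xs
      ≤⟨ sumOver-mono xs (λ {x} _ → split x) ⟩
    sumOver (λ x → restrict meetsD? (weight r) x ℚ.+ restrict avoidsD? weight′ x) xs
      ≡⟨ sumOver-+ (restrict meetsD? (weight r)) (restrict avoidsD? weight′) xs ⟩
    sumOver (restrict meetsD? (weight r)) xs ℚ.+ sumOver (restrict avoidsD? weight′) xs
      ≤⟨ ℚ.+-monoˡ-≤ (sumOver (restrict avoidsD? weight′) xs) meeting ⟩
    sumOver (restrict containsD? weight′) xs ℚ.+ sumOver (restrict avoidsD? weight′) xs
      ≡⟨ sym (sumOver-+ (restrict containsD? weight′) (restrict avoidsD? weight′) xs) ⟩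
    sumOver (λ x → restrict containsD? weight′ x ℚ.+ restrict avoidsD? weight′ x) xs
      ≤⟨ sumOver-mono xs (λ {x} _ → join x) ⟩
    sumOver (restrict (respects? D ∘ r) weight′) xs ∎
    where
    open ℚ.≤-Reasoning
    weight′ = weight (r without D)
    meetsD? = λ x → r x meets? D
    avoidsD? = λ x → ¬? (r x meets? D)
    containsD? = λ x → D ⊆? r x

    split : ∀ x → weight r x ≤ℚ restrict meetsD? (weight r) x ℚ.+ restrict avoidsD? weight′ x
    split x with meetsD? x
    ... | yes _   = ℚ.≤-reflexive (sym (ℚ.+-identityʳ _))
    ... | no r∩D  = ℚ.≤-reflexive (trans (weight-∩≡∅ r x r∩D) (sym (ℚ.+-identityˡ _)))

    join : ∀ x → restrict containsD? weight′ x ℚ.+ restrict avoidsD? weight′ x ≤ℚ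
                 restrict (respects? D ∘ r) weight′ x
    join x with containsD? x | meetsD? x
    ... | yes D⊆r | yes _  = ℚ.≤-reflexive (ℚ.+-identityʳ _)
    -- A member counted in both sums would break the bound; this cannot happen, because `D` has
    -- `d > 0` points.
    ... | yes D⊆r | no r∩D with i , i∈D ← block-nonempty {D} ∣D∣≡d
                           = contradiction (i , x∈p∩q⁺ (D⊆r i∈D , i∈D)) r∩D
    ... | no _    | yes _  = ℚ.≤-refl
    ... | no _    | no _   = ℚ.≤-reflexive (ℚ.+-identityˡ _)

    containing : ∀ x → restrict containsD? (weight r) x ≤ℚ inv M ℚ.* restrict containsD? weight′ x
    containing x with containsD? x
    ... | yes D⊆r = ℚ.≤-reflexive (weight-⊆ r x ∣D∣≡d D⊆r)
    ... | no _    = ℚ.≤-reflexive (sym (ℚ.*-zeroʳ (inv M)))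

    over-nonNeg : 0ℚ ≤ℚ weightOver xs r D
    over-nonNeg = subst (_≤ℚ weightOver xs r D) (sumOver-0 xs)
      (sumOver-mono xs (restrict-nonNeg containsD? (weight r) ∘ weight-nonNeg T))

    meeting : sumOver (restrict meetsD? (weight r)) xs ≤ℚ sumOver (restrict containsD? weight′) xs
    meeting with blocksMeeting T ∣D∣≡d
    ... | Ds , length≤ , sound , complete = begin
      sumOver (restrict meetsD? (weight r)) xs
        -- By `sound` the covering sets are themselves candidates, so none is heavier than `D`.
        ≤⟨ sumOver-cover meetsD? (λ D′ x → D′ ⊆? r x) Ds (weight-nonNeg T) complete
             (All.tabulate (D-max ∘ sound)) ⟩
      length Ds · weightOver xs r D
        ≤⟨ ·-monoˡ-≤ over-nonNeg length≤ ⟩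
      M · weightOver xs r D
        ≤⟨ ·-monoʳ-≤ M (sumOver-mono xs (λ {x} _ → containing x)) ⟩
      M · sumOver (λ x → inv M ℚ.* restrict containsD? weight′ x) xs
        ≡⟨ cong (M ·_) (sumOver-* (inv M) (restrict containsD? weight′) xs) ⟩
      M · (inv M ℚ.* sumOver (restrict containsD? weight′) xs)
        ≡⟨ ·-inv M _ ⟩
      sumOver (restrict containsD? weight′) xs ∎

  -- Iterated choice of blocks.

  without-Trace : ∀ {xs V r} → Trace xs V r → ∀ {D} → ∣ D ∣ ≡ d →
                  Trace (filter (respects? D ∘ r) xs) (V ─ D) (r without D)
  without-Trace {xs} {V} {r} T {D} ∣D∣≡d = record
    { trace⊆   = λ x∈ → ─-mono-⊆ D (trace⊆ T (old x∈))
    ; trace≤k  = λ {x} x∈ → ℕ.≤-trans (∣p─q∣≤∣p∣ (r x) D) (trace≤k T (old x∈))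
    ; ~-refl   = ~-refl T ∘ old
    -- The filter matters here: divisibility survives because both traces contain `D` or avoid it.
    -- The relation and the clique bound concern original members and pass to sublists.
    ; ~⇒∣      = λ {x} {y} x∈ y∈ x~y → subst (_∣ ∣ (r x ─ D) ∩ (r y ─ D) ∣) ∣D∣≡d
                   (∣-∩-─ (respects x∈) (respects y∈)
                     (subst (_∣ ∣ r x ∩ r y ∣) (sym ∣D∣≡d) (~⇒∣ T (old x∈) (old y∈) x~y)))
    ; clique<m = λ ys ys⊆ → clique<m T ys (old ∘ ys⊆)
    ; w-nonNeg = w-nonNeg T ∘ old
    }
    where
    old : ∀ {x} → x ∈ filter (respects? D ∘ r) xs → x ∈ xs
    old = proj₁ ∘ ∈-filter⁻ (respects? D ∘ r)
    respects : ∀ {x} → x ∈ filter (respects? D ∘ r) xs → Respects D (r x)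
    respects = proj₂ ∘ ∈-filter⁻ (respects? D ∘ r) {xs = xs}

  -- `block⊆` makes these blocks disjoint from all those already removed from the ground set. In
  -- `heavy` the left side is discounted by `inv M`, the right side is not.
  record Blocks (xs : List A) (V : Subset N) (r : A → Subset N) : Set where
    field
      {#blocks} : ℕ
      block     : Fin #blocks → Subset N
      block⊆    : ∀ i → block i ⊆ V
      ∣block∣   : ∀ i → ∣ block i ∣ ≡ d
      disjoint  : ∀ i j → i ≢ j → block i ∩ block j ≡ ⊥
      heavy     : sumOver (weight r) xs ≤ℚ sumOver (restrict (isUnionOf? block ∘ r) w) xs

  -- A non-empty trace has size at least `d`, being a multiple of it, and would contain a candidate.
  -- So all traces are empty: the exponent is 0 and each is the empty union.
  noBlocks : ∀ {xs V r} → Trace xs V r → candidates xs r ≡ [] → Blocks xs V r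
  noBlocks {xs} {V} {r} T none = record
    { block    = noBlock
    ; block⊆   = λ ()
    ; ∣block∣  = λ ()
    ; disjoint = λ ()
    ; heavy    = sumOver-mono xs λ {x} x∈xs → ℚ.≤-reflexive (begin
        (inv M ^ℚ (∣ r x ∣ ℕ./ d)) ℚ.* w x     ≡⟨ cong (λ s → (inv M ^ℚ (s ℕ./ d)) ℚ.* w x) (size≡0 x∈xs) ⟩
        1ℚ ℚ.* w x                             ≡⟨ ℚ.*-identityˡ (w x) ⟩
        w x                                    ≡⟨ sym (restrict-yes (isUnionOf? noBlock ∘ r) w (union x∈xs)) ⟩
        restrict (isUnionOf? noBlock ∘ r) w x         ∎)
    }
    where
    open ≡-Reasoning
    noBlock : Fin 0 → Subset N
    noBlock ()
    size≡0 : ∀ {x} → x ∈ xs → ∣ r x ∣ ≡ 0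
    size≡0 {x} x∈xs with ∣ r x ∣ in eq
    ... | zero  = refl
    ... | suc s with D , D⊆ , ∣D∣ ← ∃⊆-ofSize (r x) {d}
                       (subst (d ≤_) (sym eq) (∣⇒≤ (subst (d ∣_) eq (d∣trace T x∈xs))))
                with () ← subst (D ∈_) none (∈-candidates⁺ r x∈xs D⊆ ∣D∣)
    union : ∀ {x} → x ∈ xs → IsUnionOf noBlock (r x)
    union x∈xs = [] , ∣p∣≡0⇒p≡⊥ (size≡0 x∈xs)

  -- The gain of `weight-step` is followed by the bound for `V ─ D`, and `D` is put back in front of
  -- the blocks found there.
  consBlock : ∀ {xs V r} → Trace xs V r → ∀ {D} → D ⊆ V → ∣ D ∣ ≡ d →
    (∀ {D′} → D′ ∈ candidates xs r → weightOver xs r D′ ≤ℚ weightOver xs r D) →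
    Blocks (filter (respects? D ∘ r) xs) (V ─ D) (r without D) → Blocks xs V r
  consBlock {xs} {V} {r} T {D} D⊆V ∣D∣≡d D-max B = record
    { block    = block′
    ; block⊆   = λ { zero → D⊆V ; (suc i) → p─q⊆p V D ∘ block⊆ i }
    ; ∣block∣  = λ { zero → ∣D∣≡d ; (suc i) → ∣block∣ i }
    ; disjoint = λ { zero zero i≢j → contradiction refl i≢j
                   ; zero (suc j) _ → Empty-unique (apart j)
                   ; (suc i) zero _ → trans (∩-comm (block i) D) (Empty-unique (apart i))
                   ; (suc i) (suc j) i≢j → disjoint i j (i≢j ∘ cong suc) }
    ; heavy    = begin
        sumOver (weight r) xs
          ≤⟨ weight-step T ∣D∣≡d D-max ⟩
        sumOver (restrict fits? (weight (r without D))) xs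
          ≡⟨ sym (sumOver-filter fits? (weight (r without D)) xs) ⟩
        sumOver (weight (r without D)) (filter fits? xs)
          ≤⟨ heavy ⟩
        sumOver (restrict (isUnionOf? block ∘ (r without D)) w) (filter fits? xs)
          ≡⟨ sumOver-filter fits? (restrict (isUnionOf? block ∘ (r without D)) w) xs ⟩
        sumOver (restrict fits? (restrict (isUnionOf? block ∘ (r without D)) w)) xs
          -- Since `w` is non-negative on members, it suffices that every member counted on the left
          -- is a union of the extended blocks.
          ≤⟨ sumOver-mono xs extend ⟩
        sumOver (restrict (isUnionOf? block′ ∘ r) w) xs ∎
    }
    where
    open Blocks B
    open ℚ.≤-Reasoning
    block′ = D Vector.∷ block
    fits? = respects? D ∘ r
    apart : ∀ i → Empty (D ∩ block i)
    apart i (z , z∈) with x∈p∩q⁻ D (block i) z∈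
    ... | z∈D , z∈B = x∈p─q⇒x∉q {p = V} {D} (block⊆ i z∈B) z∈D
    extend : ∀ {x} → x ∈ xs → restrict fits? (restrict (isUnionOf? block ∘ (r without D)) w) x ≤ℚ
                              restrict (isUnionOf? block′ ∘ r) w x
    extend {x} x∈xs = restrict-≤ fits? (restrict (isUnionOf? block ∘ (r without D)) w) 0≤new λ fits →
      restrict-≤ (isUnionOf? block ∘ (r without D)) w 0≤new λ union →
        ℚ.≤-reflexive (sym (restrict-yes (isUnionOf? block′ ∘ r) w (IsUnionOf-cons D block fits union)))
      where
      0≤new : 0ℚ ≤ℚ restrict (isUnionOf? block′ ∘ r) w x
      0≤new = restrict-nonNeg (isUnionOf? block′ ∘ r) w (w-nonNeg T x∈xs)

  heaviest : ∀ xs r → candidates xs r ≡ [] ⊎ ∃ λ D → D ∈ candidates xs r ×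
    (∀ {D′} → D′ ∈ candidates xs r → weightOver xs r D′ ≤ℚ weightOver xs r D)
  heaviest xs r with candidates xs r
  ... | []      = inj₁ refl
  ... | D₀ ∷ Ds = inj₂
    -- The default value `D₀` is itself a candidate, so the maximiser is one in either case.
    ( argmax f D₀ Ds
    , [ here , there ]′ (argmax-sel f D₀ Ds)
    , All.lookup (f[⊥]≤f[argmax] {f = f} D₀ Ds ∷ f[xs]≤f[argmax] {f = f} D₀ Ds) )
    where f = weightOver xs r

  -- The recursion ends because the chosen `D` is a non-empty part of `V`, so `V ─ D` is strictly
  -- smaller.
  blocks : ∀ {xs V r} → Trace xs V r → Acc ℕ._<_ ∣ V ∣ → Blocks xs V r
  blocks {xs} {V} {r} T (acc rs) with heaviest xs r
  ... | inj₁ none = noBlocks T none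
  ... | inj₂ (D , D∈ , D-max) with ∈-candidates⁻ xs r D∈
  ... | x , x∈xs , D⊆rx , ∣D∣≡d = consBlock T D⊆V ∣D∣≡d D-max
    (blocks (without-Trace T ∣D∣≡d) (rs (p∩q≢∅⇒∣p─q∣<∣p∣ V D V∩D-nonempty)))
    where
    D⊆V : D ⊆ V
    D⊆V = trace⊆ T x∈xs ∘ D⊆rx
    V∩D-nonempty : Nonempty (V ∩ D)
    V∩D-nonempty = subst Nonempty (sym (p⊆q⇒q∩p≡p D⊆V)) (block-nonempty ∣D∣≡d)

-- From the construction to the stated theorem.

sumOverUnions≡sumOver : ∀ {N n} (Xs : Fin n → Subset N) fam w →
  sumOverUnions Xs fam w ≡ sumOver (restrict (isUnionOf? Xs) w) fam
sumOverUnions≡sumOver Xs []        w = refl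
sumOverUnions≡sumOver Xs (F ∷ fam) w =
  cong (restrict (isUnionOf? Xs) w F ℚ.+_) (sumOverUnions≡sumOver Xs fam w)

theorem5p1 : (k d m : ℕ) .{{_ : NonZero d}} → .{{_ : NonZero m}} → d ≤ k →
    (N : ℕ) (fam : List (Subset N)) → Unique fam →
    (∀ F → F ∈ fam → ∣ F ∣ ≤ k) →
    (∀ F → F ∈ fam → d ∣ ∣ F ∣) →
    ¬ (Σ (Fin m → Subset N) λ G → Injective _≡_ _≡_ G × (∀ i → G i ∈ fam) ×
    (∀ i j → i ≢ j → ∣ G i ∩ G j ∣ % d ≢ 0)) →
    (w : Subset N → ℚ) → (∀ F → F ∈ fam → 0ℚ ≤ℚ w F) →
    Σ ℕ λ n → Σ (Fin n → Subset N) λ Xs →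
    (∀ i → ∣ Xs i ∣ ≡ d) × (∀ i j → i ≢ j → Xs i ∩ Xs j ≡ ⊥) ×
    (sumℚ (map (w′ k d m w) fam) ≤ℚ sumOverUnions Xs fam w)
theorem5p1 k d@(suc e) m d≤k N fam _ ∣F∣≤k d∣∣F∣ noClique w 0≤w =
  #blocks , block , ∣block∣ , disjoint ,
  subst (sumOver (w′ k d m w) fam ≤ℚ_) (sym (sumOverUnions≡sumOver block fam w)) heavy
  where
  _~_ : Rel (Subset N) 0ℓ
  F ~ G = d ∣ ∣ F ∩ G ∣

  ~-refl′ : ∀ {F} → F ∈ fam → F ~ F
  ~-refl′ {F} F∈ = subst (λ G → d ∣ ∣ G ∣) (sym (∩-idem F)) (d∣∣F∣ F F∈)

  clique<m′ : ∀ Gs → (∀ {G} → G ∈ Gs → G ∈ fam) → AllPairs (λ F G → ¬ F ~ G) Gs → length Gs ℕ.< m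
  -- If the list had length at least `m`, its first `m` entries would form the excluded
  -- configuration.
  clique<m′ Gs Gs⊆fam clique = ℕ.≰⇒> λ m≤ → noClique
    ( (λ i → lookup Gs (inject≤ i m≤))
    -- Entries at distinct indices are unrelated, whereas a member is related to itself because `d`
    -- divides its size; so the entries are distinct.
    , (λ {i} {j} eq → decidable-stable (i ≟ j) λ i≢j →
        apart m≤ i≢j (subst (lookup Gs (inject≤ i m≤) ~_) eq
          (~-refl′ (Gs⊆fam (∈-lookup (inject≤ i m≤))))))
    , (λ i → Gs⊆fam (∈-lookup (inject≤ i m≤)))
    , (λ i j i≢j → apart m≤ i≢j ∘ m%n≡0⇒n∣m _ d))
    where
    apart : ∀ (m≤ : m ≤ length Gs) {i j} → i ≢ j → ¬ (lookup Gs (inject≤ i m≤) ~ lookup Gs (inject≤ j m≤))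
    apart m≤ {i} {j} i≢j = AllPairs-lookup
      (λ {F} {G} F≁G → F≁G ∘ subst (λ H → d ∣ ∣ H ∣) (∩-comm G F)) clique
      (i≢j ∘ inject≤-injective m≤ m≤ i j)

  instance
    M≢0 : NonZero (d ℕ.* (k C e) ℕ.* m)
    -- The binomial factor is positive since `e ≤ k`; `d≤k` unfolds to `e < k`.
    M≢0 = ℕ.m*n≢0 (d ℕ.* (k C e)) m {{ℕ.m*n≢0 d (k C e) {{_}} {{ℕ.>-nonZero (k≤n⇒0<nCk (ℕ.<⇒≤ d≤k))}}}}

  -- Before any removal the trace of a member is the member itself, so `weight` computes to `w′`,
  -- with `suc e ∸ 1` reducing to `e`.
  initial : Trace (λ F G → d ∣? ∣ F ∩ G ∣) w k e m fam ⊤ id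
  initial = record
    { trace⊆   = λ _ → ⊆-max _
    ; trace≤k  = ∣F∣≤k _
    ; ~-refl   = ~-refl′
    ; ~⇒∣      = λ _ _ → id
    ; clique<m = clique<m′
    ; w-nonNeg = 0≤w _
    }

  open Blocks (blocks (λ F G → d ∣? ∣ F ∩ G ∣) w k e m initial (<-wellFounded _))
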